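{- Let $n\ge 1$. There exists a bijection $f$ from the set of binary trees with $n+1$ leaves to the set of torsion classes in $A_{n-1}$ such that $f(T)=\mathcal D_T$ for every such tree $T$. Furthermore, this bijection is order reversing: if $T_1\le T_2$ in the (Tamari) order on binary trees, then $f(T_1)\supseteq f(T_2)$.
   Context: A binary tree is a finite planar rooted tree in which every internal node has exactly two children. Let $T$ have $n+1$ leaves, numbered $0,1,\dots,n$ from left to right and drawn on the bottom level; the node whose subtree has leaves $i,i+1,\dots,j$ is drawn at the grid vertex $v_{i,j}=\left(\tfrac{i+j}{2},\tfrac{j-i}{2}\right)$. Edges of the tree are straight diagonal lines: descending (going down to the right; to right children, $j$ constant) or ascending (going up to the right; to left children, $i$ constant). Order on trees. The order on binary trees is the Tamari order, generated by the moves that shift a descending edge to the right, i.e. replace a subtree of the form $(AB)C$ by $A(BC)$ (where $A,B,C$ are subtrees); the tree after the move is larger. Ball structure. The balls are indexed by pairs $[i,j]$ with $1\le i\le j\le n-1$ (no balls if $n=1$); the ball $[i,j]$ fills the unit diamond with lowest corner $v_{i,j}$, left corner $v_{i-1,j}$, right corner $v_{i,j+1}$ and top corner $v_{i-1,j+1}$. The balls represent the indecomposable objects of the category of representations of the linearly oriented quiver of type $A_{n-1}$. Hom. $\mathrm{Hom}(X,Y)\ne0$ if and only if the entire rectangle with left corner $X$ and right corner $Y$ lies in the ball structure; explicitly, $\mathrm{Hom}([i,j],[i',j'])\neq0$ if and only if $i\le i'\le j\le j'$. Torsion classes. A pair $(\mathcal G,\mathcal F)$ of subsets of balls is a torsion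 pair if $\mathcal G=\{X:\mathrm{Hom}(X,Y)=0\ \text{for all } Y\in\mathcal F\}$ and $\mathcal F=\{Y:\mathrm{Hom}(X,Y)=0\ \text{for all } X\in\mathcal G\}$. A torsion class in $A_{n-1}$ is the set $\mathcal G$ of some torsion pair $(\mathcal G,\mathcal F)$. $\mathcal D_T$ is the set of balls sitting (directly) on descending edges of $T$: $[i,j]\in\mathcal D_T$ iff the lower-left side of its diamond, from $v_{i-1,j}$ to $v_{i,j}$, lies on a descending edge of $T$; equivalently, iff $a_j<i$, where $\{a_j,\dots,j\}$ is the leaf set of the largest subtree of $T$ whose rightmost leaf is $j$. -}

module Defs where

open import Data.Nat.Base using (ℕ; suc; _+_; _∸_; _≤_; _<_)
open import Data.Product.Base using (Σ-syntax; ∃-syntax; _×_; proj₁)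
open import Data.Tree.Binary using (Tree; node; #leaves)
open import Data.Unit.Base using (⊤; tt)
open import Level using (0ℓ) renaming (suc to lsuc)
open import Relation.Binary.Bundles using (Setoid)
open import Relation.Binary.Construct.Closure.ReflexiveTransitive using (Star)
import Relation.Binary.Construct.On as On
open import Relation.Binary.PropositionalEquality.Core using (_≡_)
open import Relation.Binary.PropositionalEquality.Properties using (setoid)
open import Relation.Nullary.Negation.Core using (¬_)
open import Relation.Unary using (Pred; Decidable; _∈_; _≐_)
open import Relation.Unary.Relation.Binary.Equality using (≐-isEquivalence)

Shape : Set
Shape = Tree ⊤ ⊤

infix 7 _∧_
pattern _∧_ A B = node A tt B

-- n counts all leaves but one: the leaves are numbered 0, 1, …, n.
BinaryTree : ℕ → Set
BinaryTree n = Σ[ t ∈ Shape ] #leaves t ≡ suc n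

infix 4 _⟶_ _≤ᵀ_

data _⟶_ : Shape → Shape → Set where
  rotate : ∀ {A B C} → (A ∧ B) ∧ C ⟶ A ∧ (B ∧ C)
  inˡ    : ∀ {A A′ B} → A ⟶ A′ → A ∧ B ⟶ A′ ∧ B
  inʳ    : ∀ {A B B′} → B ⟶ B′ → A ∧ B ⟶ A ∧ B′

-- The Tamari order.  Moves preserve the number of leaves, so a chain of moves
-- between trees with n + 1 leaves stays among such trees.
_≤ᵀ_ : ∀ {n} → BinaryTree n → BinaryTree n → Set
T₁ ≤ᵀ T₂ = Star _⟶_ (proj₁ T₁) (proj₁ T₂)

-- S At a In T : S occurs as a subtree of T with leftmost leaf number a
-- (hence with rightmost leaf number a + #leaves S - 1).
data _At_In_ (S : Shape) : ℕ → Shape → Set where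
  here  : S At 0 In S
  left  : ∀ {a A B} → S At a In A → S At a In (A ∧ B)
  right : ∀ {a A B} → S At a In B → S At (#leaves A + a) In (A ∧ B)

-- T has a descending edge from v_{a,j} down to v_{k,j}: an internal node with
-- leaves a, …, j whose right child has leaves k, …, j.
DescendingEdge : Shape → ℕ → ℕ → ℕ → Set
DescendingEdge T a k j =
  ∃[ A ] ∃[ B ] (A ∧ B) At a In T × k ≡ a + #leaves A × suc j ≡ k + #leaves B

record Ball (n : ℕ) : Set where
  constructor ball
  field
    i j   : ℕ
    1≤i   : 1 ≤ i
    i≤j   : i ≤ j
    j≤n-1 : j ≤ n ∸ 1

open Ball

-- Hom≢0 X Y stands for Hom(X,Y) ≠ 0.
Hom≢0 : ∀ {n} → Ball n → Ball n → Set
Hom≢0 X Y = i X ≤ i Y × i Y ≤ j X × j X ≤ j Y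

IsTorsionPair : ∀ {n} → Pred (Ball n) 0ℓ → Pred (Ball n) 0ℓ → Set
IsTorsionPair G F =
  (G ≐ λ X → ∀ Y → Y ∈ F → ¬ Hom≢0 X Y) ×
  (F ≐ λ Y → ∀ X → X ∈ G → ¬ Hom≢0 X Y)

-- Subsets of the finite set of balls are the decidable predicates, with
-- equality _≐_ (having the same elements).
record TorsionClass (n : ℕ) : Set₁ where
  field
    𝒢              : Pred (Ball n) 0ℓ
    𝒢?             : Decidable 𝒢
    isTorsionClass : Σ[ ℱ ∈ Pred (Ball n) 0ℓ ] Decidable ℱ × IsTorsionPair 𝒢 ℱ

open TorsionClass public using (𝒢)

binaryTrees : ℕ → Setoid 0ℓ 0ℓ
binaryTrees n = setoid (BinaryTree n)

torsionClasses : ℕ → Setoid (lsuc 0ℓ) 0ℓ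
torsionClasses n = record
  { Carrier       = TorsionClass n
  ; _≈_           = λ G G′ → 𝒢 G ≐ 𝒢 G′
  ; isEquivalence = On.isEquivalence 𝒢 ≐-isEquivalence
  }

-- The lower-left side of the diamond of [i,j] joins v_{i-1,j} to v_{i,j}; it
-- lies on the edge from v_{a,j} to v_{k,j} iff a ≤ i - 1 and i ≤ k.
𝒟 : ∀ {n} → BinaryTree n → Pred (Ball n) 0ℓ
𝒟 T X = ∃[ a ] ∃[ k ] DescendingEdge (proj₁ T) a k (j X) × a < i X × i X ≤ k

{-# OPTIONS --safe #-}

-- A tree is encoded by its bracket vector l, where l j is the leftmost leaf of
-- the largest subtree with rightmost leaf j < n: then [i,j] ∈ 𝒟_T iff l j < i.
-- The bracket vectors are the l with l j ≤ j and l j ≤ l i whenever l j ≤ i ≤ j,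
-- and a tree is recovered from l by rooting it at the last j with l j minimal.
-- Torsion classes have the same encoding: closure under quotients makes
-- membership of [i,j] a threshold condition l j < i for each j, and closure
-- under extensions is the nesting condition on l.  Conversely the torsion-free
-- class belonging to l consists of the [i,j] with i ≤ l k for all i ≤ k ≤ j.
module Submission where

open import Data.Nat.Base using (ℕ; zero; suc; _+_; _≤_; _<_; z≤n; s≤s; s≤s⁻¹; z<s)
open import Data.Nat.Properties
open import Data.Product.Base using (Σ-syntax; ∃-syntax; _×_; _,_; proj₁; proj₂)
open import Data.Sum.Base using (inj₁; inj₂)
open import Data.Tree.Binary using (leaf; #leaves)
open import Function.Base using (_∘_)
open import Function.Bundles using (Bijection)
open import Level using (0ℓ)
open import Relation.Binary.Construct.Closure.ReflexiveTransitive using (Star; ε; _◅_)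
open import Relation.Binary.Definitions using (tri<; tri≈; tri>)
open import Relation.Binary.PropositionalEquality
  using (_≡_; _≢_; refl; sym; trans; cong; cong₂; subst)
open import Relation.Nullary.Decidable using (Dec; yes; no; _→-dec_)
open import Relation.Nullary.Negation using (¬_; contradiction)
open import Relation.Unary using (Pred; Decidable; _∈_; _≐_; _⊇_)
open import Defs

open Ball renaming (i to lo; j to hi)

private
  variable
    a b e i j k m n s : ℕ
    A B T T′ : Shape
    l l′ : ℕ → ℕ

-- Bracket vectors

-- The inner nodes s, …, e - 1 of T, in in-order (node j separates leaves j and
-- j + 1), have left subtrees with leaves l j, …, j; the leaves of T are s, …, e.
data Realises (l : ℕ → ℕ) : ℕ → ℕ → Shape → Set where
  leaf : Realises l s s (leaf _)
  node : ∀ {r} → Realises l s r A → l r ≡ s → Realises l (suc r) e B →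
         Realises l s e (A ∧ B)

record Bracket (l : ℕ → ℕ) (s e : ℕ) : Set where
  field
    lower  : s ≤ j → j < e → s ≤ l j
    upper  : s ≤ j → j < e → l j ≤ j
    nested : s ≤ j → j < e → l j ≤ i → i ≤ j → l j ≤ l i

open Bracket

realises-≤ : Realises l s e T → s ≤ e
realises-≤ leaf = ≤-refl
realises-≤ (node p _ q) = ≤-trans (realises-≤ p) (<⇒≤ (realises-≤ q))

realises-#leaves : Realises l s e T → s + #leaves T ≡ suc e
realises-#leaves {s = s} leaf = +-comm s 1
realises-#leaves {s = s} (node {A = A} {B = B} p _ q) =
  trans (sym (+-assoc s (#leaves A) (#leaves B)))
    (trans (cong (_+ #leaves B) (realises-#leaves p)) (realises-#leaves q))

realises-cong : (∀ {j} → s ≤ j → j < e → l j ≡ l′ j) →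
                Realises l s e T → Realises l′ s e T
realises-cong l≗l′ leaf = leaf
realises-cong l≗l′ (node p eq q) =
  node (realises-cong (λ s≤j j<r → l≗l′ s≤j (<-trans j<r r<e)) p)
       (trans (sym (l≗l′ s≤r r<e)) eq)
       (realises-cong (λ r<j → l≗l′ (≤-trans s≤r (<⇒≤ r<j))) q)
  where
  s≤r = realises-≤ p
  r<e = realises-≤ q

-- Away from the root `r`, an index `j` and its interval from `l j` to `j` lie within one subtree;
-- at the root `l r ≡ s`, so nestedness there is just the lower bound.
realises⇒bracket : Realises l s e T → Bracket l s e
realises⇒bracket leaf = record
  { lower  = λ s≤j j<s → contradiction s≤j (<⇒≱ j<s)
  ; upper  = λ s≤j j<s → contradiction s≤j (<⇒≱ j<s)
  ; nested = λ s≤j j<s → contradiction s≤j (<⇒≱ j<s)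
  }
realises⇒bracket {l} {s} {e} (node {r = r} p lr≡s q) = record
  { lower = low ; upper = up ; nested = nest }
  where
  bp = realises⇒bracket p
  bq = realises⇒bracket q
  s≤r = realises-≤ p

  low : s ≤ j → j < e → s ≤ l j
  low {j} s≤j j<e with <-cmp j r
  ... | tri< j<r _ _  = lower bp s≤j j<r
  ... | tri≈ _ refl _ = ≤-reflexive (sym lr≡s)
  ... | tri> _ _ r<j  = ≤-trans s≤r (<⇒≤ (lower bq r<j j<e))

  up : s ≤ j → j < e → l j ≤ j
  up {j} s≤j j<e with <-cmp j r
  ... | tri< j<r _ _  = upper bp s≤j j<r
  ... | tri≈ _ refl _ = ≤-trans (≤-reflexive lr≡s) s≤r
  ... | tri> _ _ r<j  = upper bq r<j j<e

  nest : s ≤ j → j < e → l j ≤ i → i ≤ j → l j ≤ l i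
  nest {j} s≤j j<e lj≤i i≤j with <-cmp j r
  ... | tri< j<r _ _  = nested bp s≤j j<r lj≤i i≤j
  ... | tri≈ _ refl _ =
    ≤-trans (≤-reflexive lr≡s) (low (≤-trans (≤-reflexive (sym lr≡s)) lj≤i) (≤-<-trans i≤j j<e))
  ... | tri> _ _ r<j  = nested bq r<j j<e lj≤i i≤j

-- Indices in a right subtree have values above its root's index, hence above `s`. Of two different
-- roots, the later one would violate `l r ≡ s`.
realises-unique : Realises l s e T → Realises l s e T′ → T ≡ T′
realises-unique leaf leaf = refl
realises-unique leaf (node p _ q) = contradiction (realises-≤ p) (<⇒≱ (realises-≤ q))
realises-unique (node p _ q) leaf = contradiction (realises-≤ p) (<⇒≱ (realises-≤ q))
realises-unique (node {r = r} p lr≡s q) (node {r = r′} p′ lr′≡s q′) with <-cmp r r′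
... | tri≈ _ refl _ = cong₂ _∧_ (realises-unique p p′) (realises-unique q q′)
... | tri< r<r′ _ _ =
  contradiction (realises-≤ p)
    (<⇒≱ (≤-trans (lower (realises⇒bracket q) r<r′ (realises-≤ q′)) (≤-reflexive lr′≡s)))
... | tri> _ _ r′<r =
  contradiction (realises-≤ p′)
    (<⇒≱ (≤-trans (lower (realises⇒bracket q′) r′<r (realises-≤ q)) (≤-reflexive lr≡s)))

realisable : ∀ s T → ∃[ l ] ∃[ e ] Realises l s e T
-- A leaf has no inner node, so the constant 0 is only a filler.
realisable s (leaf _) = (λ _ → 0) , s , leaf
realisable s (A ∧ B) with realisable s A
... | lA , r , p with realisable (suc r) B
...   | lB , e , q =
  glue , e , node (realises-cong (λ _ → glue-<) p) glue-≡ (realises-cong (λ r<j _ → glue-> r<j) q)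
  where
  glue : ℕ → ℕ
  glue j with <-cmp j r
  ... | tri< _ _ _ = lA j
  ... | tri≈ _ _ _ = s
  ... | tri> _ _ _ = lB j

  glue-< : ∀ {j} → j < r → lA j ≡ glue j
  glue-< {j} j<r with <-cmp j r
  ... | tri< _ _ _   = refl
  ... | tri≈ j≮r _ _ = contradiction j<r j≮r
  ... | tri> j≮r _ _ = contradiction j<r j≮r

  glue-≡ : glue r ≡ s
  glue-≡ with <-cmp r r
  ... | tri< _ r≢r _ = contradiction refl r≢r
  ... | tri≈ _ _ _   = refl
  ... | tri> _ r≢r _ = contradiction refl r≢r

  glue-> : ∀ {j} → r < j → lB j ≡ glue j
  glue-> {j} r<j with <-cmp j r
  ... | tri< _ _ r≮j = contradiction r<j r≮j
  ... | tri≈ _ _ r≮j = contradiction r<j r≮j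
  ... | tri> _ _ _   = refl

-- The search runs down from `e - 1` and succeeds at `s` at the latest.
last-root : ∀ e → s < e → l s ≡ s →
            ∃[ r ] s ≤ r × r < e × l r ≡ s × (∀ {j} → r < j → j < e → l j ≢ s)
last-root {s} {l} (suc e) s≤e ls≡s with l e ≟ s
... | yes le≡s = e , s≤s⁻¹ s≤e , ≤-refl , le≡s , λ e<j j≤e → contradiction e<j (≤⇒≯ (s≤s⁻¹ j≤e))
... | no le≢s with m<1+n⇒m<n∨m≡n s≤e
...   | inj₂ refl = contradiction ls≡s le≢s
...   | inj₁ s<e with last-root e s<e ls≡s
...     | r , s≤r , r<e , lr≡s , after = r , s≤r , m<n⇒m<1+n r<e , lr≡s , after′
  where
  after′ : ∀ {j} → r < j → j < suc e → l j ≢ s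
  after′ r<j j≤e with m<1+n⇒m<n∨m≡n j≤e
  ... | inj₁ j<e  = after r<j j<e
  ... | inj₂ refl = le≢s

-- k bounds e - s, so that the recursion is structural.
bracket⇒realised : ∀ k → e ≤ s + k → s ≤ e → Bracket l s e → ∃[ T ] Realises l s e T
bracket⇒realised {e} {s} {l} k e≤s+k s≤e bracket with m≤n⇒m<n∨m≡n s≤e
... | inj₂ refl = leaf _ , leaf
bracket⇒realised {e} {s} zero e≤s+k _ _ | inj₁ s<e =
  contradiction (≤-trans e≤s+k (≤-reflexive (+-identityʳ s))) (<⇒≱ s<e)
bracket⇒realised {e} {s} {l} (suc k) e≤s+k _ bracket | inj₁ s<e
  -- At index `s` the bounds `upper` and `lower` squeeze `l s` to `s`, which starts the search.
  with last-root {l = l} e s<e (≤-antisym (upper bracket ≤-refl s<e) (lower bracket ≤-refl s<e))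
... | r , s≤r , r<e , lr≡s , after = _ , node (proj₂ left-part) lr≡s (proj₂ right-part)
  where
  e≤1+s+k : e ≤ suc (s + k)
  e≤1+s+k = ≤-trans e≤s+k (≤-reflexive (+-suc s k))

  left-part = bracket⇒realised {r} {s} {l} k (s≤s⁻¹ (≤-trans r<e e≤1+s+k)) s≤r record
    { lower  = λ s≤j j<r → lower bracket s≤j (<-trans j<r r<e)
    ; upper  = λ s≤j j<r → upper bracket s≤j (<-trans j<r r<e)
    ; nested = λ s≤j j<r → nested bracket s≤j (<-trans j<r r<e)
    }

  s≤ : r < j → s ≤ j
  s≤ r<j = ≤-trans s≤r (<⇒≤ r<j)

  -- If l j ≤ r, nestedness gives l j ≤ l r = s, against the choice of r.
  right-lower : r < j → j < e → r < l j
  right-lower r<j j<e = ≰⇒> λ lj≤r → after r<j j<e (≤-antisym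
    (≤-trans (nested bracket (s≤ r<j) j<e lj≤r (<⇒≤ r<j)) (≤-reflexive lr≡s))
    (lower bracket (s≤ r<j) j<e))

  e≤1+r+k = ≤-trans e≤1+s+k (s≤s (+-monoˡ-≤ k s≤r))

  right-part = bracket⇒realised {e} {suc r} {l} k e≤1+r+k r<e record
    { lower  = right-lower
    ; upper  = λ r<j → upper bracket (s≤ r<j)
    ; nested = λ r<j → nested bracket (s≤ r<j)
    }

-- Descending edges

-- 𝒟 as an inductive predicate, for T with leftmost leaf s.
data Covers (i j : ℕ) : ℕ → Shape → Set where
  edge  : s < i → i ≤ s + #leaves A → suc j ≡ s + #leaves A + #leaves B → Covers i j s (A ∧ B)
  left  : Covers i j s A → Covers i j s (A ∧ B)
  right : Covers i j (s + #leaves A) B → Covers i j s (A ∧ B)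

shift-covers : b ≡ s → Covers i j b T → Covers i j s T
shift-covers refl c = c

-- The absolute position `b` is kept apart from its splitting `s + a`: entering a right child moves
-- leaves from `a` to `s`, while the conditions on `b` stay unchanged.
at⇒covers : ∀ s → (A ∧ B) At a In T → b ≡ s + a → b < i → i ≤ b + #leaves A →
            suc j ≡ b + #leaves A + #leaves B → Covers i j s T
at⇒covers s here b≡s+0 b<i i≤ j≡ with trans b≡s+0 (+-identityʳ s)
... | refl = edge b<i i≤ j≡
at⇒covers s (left at) b≡ b<i i≤ j≡ = left (at⇒covers s at b≡ b<i i≤ j≡)
at⇒covers s (right {a} {A} at) b≡ b<i i≤ j≡ =
  right (at⇒covers _ at (trans b≡ (sym (+-assoc s (#leaves A) a))) b<i i≤ j≡)

covers⇒at : Covers i j s T →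
            ∃[ a ] ∃[ A ] ∃[ B ] (A ∧ B) At a In T × s + a < i × i ≤ s + a + #leaves A ×
              suc j ≡ s + a + #leaves A + #leaves B
covers⇒at {i} {j} {s} (edge {A = A} {B} s<i i≤ j≡) = 0 , A , B , here ,
  subst (λ b → b < i × i ≤ b + #leaves A × suc j ≡ b + #leaves A + #leaves B)
    (sym (+-identityʳ s)) (s<i , i≤ , j≡)
covers⇒at (left c) with covers⇒at c
... | a , A , B , at , rest = a , A , B , left at , rest
covers⇒at {i} {j} {s} (right {A = A′} c) with covers⇒at c
... | a , A , B , at , rest = #leaves A′ + a , A , B , right at ,
  subst (λ b → b < i × i ≤ b + #leaves A × suc j ≡ b + #leaves A + #leaves B)
    (+-assoc s (#leaves A′) a) rest

𝒟⇒covers : (T : BinaryTree n) (X : Ball n) → X ∈ 𝒟 T → Covers (lo X) (hi X) 0 (proj₁ T)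
𝒟⇒covers T X (a , _ , (A , B , at , refl , j≡) , a<i , i≤k) = at⇒covers 0 at refl a<i i≤k j≡

covers⇒𝒟 : (T : BinaryTree n) (X : Ball n) → Covers (lo X) (hi X) 0 (proj₁ T) → X ∈ 𝒟 T
covers⇒𝒟 T X c with covers⇒at c
... | a , A , B , at , a<i , i≤k , j≡ = a , _ , (A , B , at , refl , j≡) , a<i , i≤k

⟶-#leaves : T ⟶ T′ → #leaves T ≡ #leaves T′
⟶-#leaves (rotate {A} {B} {C}) = +-assoc (#leaves A) (#leaves B) (#leaves C)
⟶-#leaves (inˡ {B = B} t) = cong (_+ #leaves B) (⟶-#leaves t)
⟶-#leaves (inʳ {A = A} t) = cong (#leaves A +_) (⟶-#leaves t)

-- In (A ∧ B) ∧ C the root edge covers both the root edge of A ∧ (B ∧ C) and that of B ∧ C.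
⟶-covers : T ⟶ T′ → Covers i j s T′ → Covers i j s T
⟶-covers {s = s} (rotate {A} {B} {C}) (edge s<i i≤ j≡) =
  edge s<i (≤-trans i≤ (+-monoʳ-≤ s (m≤m+n _ _)))
    (trans j≡ (trans (sym (+-assoc (s + #leaves A) _ _)) (cong (_+ #leaves C) (+-assoc s _ _))))
⟶-covers rotate (left c) = left (left c)
⟶-covers {s = s} (rotate {A} {B} {C}) (right (edge s<i i≤ j≡)) =
  edge (≤-<-trans (m≤m+n s _) s<i) (≤-trans i≤ (≤-reflexive (+-assoc s _ _)))
    (trans j≡ (cong (_+ #leaves C) (+-assoc s _ _)))
⟶-covers rotate (right (left c)) = left (right c)
⟶-covers {s = s} (rotate {A}) (right (right c)) =
  right (shift-covers (+-assoc s (#leaves A) _) c)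
⟶-covers {i = i} {j} {s} (inˡ {A} {B = B} t) (edge s<i i≤ j≡) =
  edge s<i (≤-trans i≤ (≤-reflexive (cong (s +_) (sym (⟶-#leaves t)))))
    (trans j≡ (cong (λ x → s + x + #leaves B) (sym (⟶-#leaves t))))
⟶-covers (inˡ t) (left c) = left (⟶-covers t c)
⟶-covers {s = s} (inˡ t) (right c) =
  right (shift-covers (cong (s +_) (sym (⟶-#leaves t))) c)
⟶-covers {s = s} (inʳ {A = A} t) (edge s<i i≤ j≡) =
  edge s<i i≤ (trans j≡ (cong (s + #leaves A +_) (sym (⟶-#leaves t))))
⟶-covers (inʳ t) (left c) = left c
⟶-covers (inʳ t) (right c) = right (⟶-covers t c)

≤ᵀ⇒𝒟⊇ : (T₁ T₂ : BinaryTree n) → T₁ ≤ᵀ T₂ → 𝒟 T₁ ⊇ 𝒟 T₂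
≤ᵀ⇒𝒟⊇ T₁ T₂ T₁≤T₂ {X} X∈𝒟T₂ = covers⇒𝒟 T₁ X (go T₁≤T₂ (𝒟⇒covers T₂ X X∈𝒟T₂))
  where
  go : ∀ {S S′} → Star _⟶_ S S′ → Covers i j s S′ → Covers i j s S
  go ε        c = c
  go (t ◅ ts) c = ⟶-covers t (go ts c)

-- The last bound is guarded by `j < e` because the vector of `T` carries no information at its last
-- leaf `e`.
covers⇒bounds : Realises l s e T → Covers i j s T → s < i × i ≤ j × j ≤ e × (j < e → l j < i)
covers⇒bounds {s = s} {e} {i = i} {j} (node {B = B} {r = r} p _ q) (edge s<i i≤ j≡) =
  s<i , ≤-trans i≤1+r (≤-trans (realises-≤ q) (≤-reflexive (sym j≡e))) , ≤-reflexive j≡e ,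
  λ j<e → contradiction j≡e (<⇒≢ j<e)
  where
  i≤1+r : i ≤ suc r
  i≤1+r = ≤-trans i≤ (≤-reflexive (realises-#leaves p))
  j≡e : j ≡ e
  j≡e = suc-injective
    (trans j≡ (trans (cong (_+ #leaves B) (realises-#leaves p)) (realises-#leaves q)))
covers⇒bounds {l = l} {e = e} {i = i} {j} (node {r = r} p lr≡s q) (left c) with covers⇒bounds p c
... | s<i , i≤j , j≤r , lj<i = s<i , i≤j , ≤-trans j≤r (<⇒≤ (realises-≤ q)) , λ _ → bound
  where
  bound : l j < i
  -- For `j = r` the left subtree says nothing about `l j`; the root does, by `l r ≡ s`.
  bound with m≤n⇒m<n∨m≡n j≤r
  ... | inj₁ j<r  = lj<i j<r
  ... | inj₂ refl = ≤-<-trans (≤-reflexive lr≡s) s<i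
covers⇒bounds (node p _ q) (right c)
  with covers⇒bounds q (shift-covers (realises-#leaves p) c)
... | 1+r<i , rest = ≤-<-trans (≤-trans (realises-≤ p) (n≤1+n _)) 1+r<i , rest

-- The edges of the right spine join up to one descending line from the root to leaf `e`, so every
-- `i` above `s` is met.
covers-right-spine : Realises l s e T → s < i → i ≤ e → Covers i e s T
covers-right-spine leaf s<i i≤e = contradiction i≤e (<⇒≱ s<i)
covers-right-spine {i = i} (node {B = B} {r = r} p _ q) s<i i≤e with i ≤? suc r
... | yes i≤1+r = edge s<i (≤-trans i≤1+r (≤-reflexive (sym (realises-#leaves p))))
  (sym (trans (cong (_+ #leaves B) (realises-#leaves p)) (realises-#leaves q)))
... | no i≰1+r = right (shift-covers (sym (realises-#leaves p))
  (covers-right-spine q (≰⇒> i≰1+r) i≤e))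

-- The recursion descends to inner node `j`; leaf `j` ends its left subtree, whose right spine
-- carries the required edge.
bounds⇒covers : Realises l s e T → s ≤ j → j < e → l j < i → i ≤ j → Covers i j s T
bounds⇒covers leaf s≤j j<s _ _ = contradiction s≤j (<⇒≱ j<s)
bounds⇒covers {j = j} (node {r = r} p lr≡s q) s≤j j<e lj<i i≤j with <-cmp j r
... | tri< j<r _ _  = left (bounds⇒covers p s≤j j<r lj<i i≤j)
... | tri≈ _ refl _ = left (covers-right-spine p (≤-<-trans (≤-reflexive (sym lr≡s)) lj<i) i≤j)
... | tri> _ _ r<j  = right (shift-covers (sym (realises-#leaves p))
  (bounds⇒covers q r<j j<e lj<i i≤j))

-- Torsion classes

bracket⇒torsion : ∀ l → Bracket l 0 (suc m) → TorsionClass (suc m)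
bracket⇒torsion {m} l bracket = record
  { 𝒢  = G
  ; 𝒢? = λ X → l (hi X) <? lo X
  ; isTorsionClass = F , F? ,
      ((λ {X} X∈G Y → orthogonal {X} {Y} X∈G) , λ {X} → F⊥⊆ {X}) ,
      ((λ {Y} Y∈F X X∈G → orthogonal {X} {Y} X∈G Y∈F) , λ {Y} → G⊥⊆ {Y})
  }
  where
  G F : Pred (Ball (suc m)) 0ℓ
  G X = l (hi X) < lo X
  -- The bound `k < suc (hi Y)` has the form that `allUpTo?` decides.
  F Y = ∀ {k} → k < suc (hi Y) → lo Y ≤ k → lo Y ≤ l k

  F? : Decidable F
  F? Y = allUpTo? (λ k → (lo Y ≤? k) →-dec (lo Y ≤? l k)) (suc (hi Y))

  orthogonal : ∀ {X Y} → X ∈ G → Y ∈ F → ¬ Hom≢0 X Y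
  orthogonal X∈G Y∈F (iX≤iY , iY≤jX , jX≤jY) =
    -- Membership of `Y` in `F` is used at `k = hi X`, giving `lo X ≤ lo Y ≤ l (hi X)`.
    contradiction (≤-trans iX≤iY (Y∈F (s≤s jX≤jY) iY≤jX)) (<⇒≱ X∈G)

  -- If X = [i,j] is not in G, then [l j,j] is in F and receives a map from X.
  F⊥⊆ : ∀ {X} → (∀ Y → Y ∈ F → ¬ Hom≢0 X Y) → X ∈ G
  F⊥⊆ {ball i j 1≤i i≤j j≤m} X∈F⊥ = ≰⇒> λ i≤lj →
    X∈F⊥ (ball (l j) j (≤-trans 1≤i i≤lj) lj≤j j≤m)
      (λ k≤j lj≤k → nested bracket z≤n (s≤s j≤m) lj≤k (s≤s⁻¹ k≤j))
      (i≤lj , lj≤j , ≤-refl)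
    where
    lj≤j : l j ≤ j
    lj≤j = upper bracket z≤n (s≤s j≤m)

  -- A violation `l k < i` would put the subobject [i,k] of [i,j] into `G`.
  G⊥⊆ : ∀ {Y} → (∀ X → X ∈ G → ¬ Hom≢0 X Y) → Y ∈ F
  G⊥⊆ {ball i j 1≤i i≤j j≤m} Y∈G⊥ {k} k≤j i≤k = ≮⇒≥ λ lk<i →
    Y∈G⊥ (ball i k 1≤i i≤k (≤-trans (s≤s⁻¹ k≤j) j≤m)) lk<i (≤-refl , i≤k , s≤s⁻¹ k≤j)

-- The threshold is the largest failure of `P` up to `j`, found by searching downwards; failure at 0
-- guarantees that it exists.
threshold : {P : Pred ℕ 0ℓ} → Decidable P → ¬ P 0 → (∀ {i i′} → P i → i ≤ i′ → i′ ≤ j → P i′) →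
            ∃[ t ] t ≤ j × (∀ {i} → i ≤ j → P i → t < i) × (∀ {i} → i ≤ j → t < i → P i)
threshold {j} {P} P? ¬P0 up = search j ≤-refl λ i≤j j<i → contradiction i≤j (<⇒≱ j<i)
  where
  search : ∀ t → t ≤ j → (∀ {i} → i ≤ j → t < i → P i) →
           ∃[ t ] t ≤ j × (∀ {i} → i ≤ j → P i → t < i) × (∀ {i} → i ≤ j → t < i → P i)
  search t t≤j above with P? t
  ... | no ¬Pt = t , t≤j , (λ _ Pi → ≰⇒> λ i≤t → ¬Pt (up Pi i≤t t≤j)) , above
  search zero t≤j above | yes P0 = contradiction P0 ¬P0
  search (suc t) t≤j above | yes Pt = search t (<⇒≤ t≤j) above′
    where
    above′ : ∀ {i} → i ≤ j → t < i → P i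
    above′ i≤j t<i = up Pt t<i i≤j

module _ {m : ℕ} (G : TorsionClass (suc m)) where
  open TorsionClass G using (𝒢?; isTorsionClass)

  private
    F : Pred (Ball (suc m)) 0ℓ
    F = proj₁ isTorsionClass

    ⊆F⊥ : ∀ {X} → X ∈ 𝒢 G → ∀ Y → Y ∈ F → ¬ Hom≢0 X Y
    ⊆F⊥ = proj₁ (proj₁ (proj₂ (proj₂ isTorsionClass)))

    F⊥⊆ : ∀ {X} → (∀ Y → Y ∈ F → ¬ Hom≢0 X Y) → X ∈ 𝒢 G
    F⊥⊆ = proj₂ (proj₁ (proj₂ (proj₂ isTorsionClass)))

  -- `Y` is a quotient of `X`, so a nonzero map out of `Y` composes to one out of `X`. With equal
  -- ends this also transfers membership between balls that differ only in their proofs.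
  quotient-closed : ∀ X Y → X ∈ 𝒢 G → lo X ≤ lo Y → hi X ≡ hi Y → Y ∈ 𝒢 G
  quotient-closed X Y X∈G iX≤iY refl = F⊥⊆ λ Z Z∈F (iY≤iZ , rest) →
    ⊆F⊥ X∈G Z Z∈F (≤-trans iX≤iY iY≤iZ , rest)

  -- `X` is a subobject of `Z` with quotient `Y`. A nonzero map from `Z` to `W` restricts to a
  -- nonzero map on `X` if `W` starts within `X`, and otherwise factors through `Y`.
  extension-closed : ∀ X Y Z → X ∈ 𝒢 G → Y ∈ 𝒢 G →
                     lo X ≡ lo Z → suc (hi X) ≡ lo Y → hi Y ≡ hi Z → Z ∈ 𝒢 G
  extension-closed X Y Z X∈G Y∈G refl refl refl = F⊥⊆ go
    where
    go : ∀ W → W ∈ F → ¬ Hom≢0 Z W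
    go W W∈F (iZ≤iW , iW≤jZ , jZ≤jW) with lo W ≤? hi X
    ... | yes iW≤jX = ⊆F⊥ X∈G W W∈F
      (iZ≤iW , iW≤jX , ≤-trans (n≤1+n _) (≤-trans (i≤j Y) jZ≤jW))
    ... | no iW≰jX = ⊆F⊥ Y∈G W W∈F (≰⇒> iW≰jX , iW≤jZ , jZ≤jW)

  -- Stated for arbitrary numbers, so that `threshold` can test every `i`, including 0, where no
  -- ball exists.
  Contains : ℕ → ℕ → Set
  Contains i j = ∃[ X ] lo X ≡ i × hi X ≡ j × X ∈ 𝒢 G

  contains-up : ∀ {i i′} → Contains i j → i ≤ i′ → i′ ≤ j → Contains i′ j
  contains-up (X@(ball _ _ 1≤i _ j≤m) , refl , refl , X∈G) i≤i′ i′≤j =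
    Y , refl , refl , quotient-closed X Y X∈G i≤i′ refl
    where Y = ball _ _ (≤-trans 1≤i i≤i′) i′≤j j≤m

  contains? : ∀ i j → Dec (Contains i j)
  contains? i j with 1 ≤? i | i ≤? j | j ≤? m
  ... | no 1≰i | _ | _ = no λ { (X , refl , refl , _) → 1≰i (1≤i X) }
  ... | yes _ | no i≰j | _ = no λ { (X , refl , refl , _) → i≰j (i≤j X) }
  ... | yes _ | yes _ | no j≰m = no λ { (X , refl , refl , _) → j≰m (j≤n-1 X) }
  ... | yes 1≤i | yes i≤j | yes j≤m with 𝒢? (ball i j 1≤i i≤j j≤m)
  ...   | yes X∈G = yes (_ , refl , refl , X∈G)
  ...   | no X∉G = no λ { (Y , refl , refl , Y∈G) → X∉G (quotient-closed Y _ Y∈G ≤-refl refl) }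

  contains⇒∈ : ∀ X → Contains (lo X) (hi X) → X ∈ 𝒢 G
  contains⇒∈ X (Y , iY≡iX , jY≡jX , Y∈G) = quotient-closed Y X Y∈G (≤-reflexive iY≡iX) jY≡jX

  torsion-threshold : ∀ j → ∃[ t ] t ≤ j × (∀ {i} → i ≤ j → Contains i j → t < i) ×
                                           (∀ {i} → i ≤ j → t < i → Contains i j)
  torsion-threshold j =
    threshold (λ i → contains? i j)
      (λ (X , iX≡0 , _) → contradiction (1≤i X) (<⇒≱ (s≤s (≤-reflexive iX≡0))))
      contains-up

  leftEnd : ℕ → ℕ
  leftEnd j = proj₁ (torsion-threshold j)

  leftEnd-≤ : ∀ j → leftEnd j ≤ j
  leftEnd-≤ j = proj₁ (proj₂ (torsion-threshold j))

  ∈⇒leftEnd< : ∀ X → X ∈ 𝒢 G → leftEnd (hi X) < lo X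
  ∈⇒leftEnd< X X∈G =
    proj₁ (proj₂ (proj₂ (torsion-threshold (hi X)))) (i≤j X)
    (X , refl , refl , X∈G)

  leftEnd<⇒∈ : ∀ X → leftEnd (hi X) < lo X → X ∈ 𝒢 G
  leftEnd<⇒∈ X t<i = contains⇒∈ X (proj₂ (proj₂ (proj₂ (torsion-threshold (hi X)))) (i≤j X) t<i)

  -- With t = leftEnd j: were [t,i] in G, then [t,j] would be in G as an
  -- extension of [t,i] and [i+1,j].
  torsion⇒bracket : Bracket leftEnd 0 (suc m)
  torsion⇒bracket = record { lower = λ _ _ → z≤n ; upper = λ _ _ → leftEnd-≤ _ ; nested = nest }
    where
    nest : ∀ {j i} → 0 ≤ j → j < suc m → leftEnd j ≤ i → i ≤ j → leftEnd j ≤ leftEnd i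
    nest {j} {i} _ j≤m t≤i i≤j with m≤n⇒m<n∨m≡n i≤j
    ... | inj₂ refl = ≤-refl
    ... | inj₁ i<j = ≮⇒≥ λ li<t →
      let 0<t = ≤-trans z<s li<t
          X = ball (leftEnd j) i 0<t t≤i (≤-trans i≤j (s≤s⁻¹ j≤m))
          Y = ball (suc i) j z<s i<j (s≤s⁻¹ j≤m)
          Z = ball (leftEnd j) j 0<t (leftEnd-≤ j) (s≤s⁻¹ j≤m)
          Z∈G = extension-closed X Y Z (leftEnd<⇒∈ X li<t) (leftEnd<⇒∈ Y (s≤s t≤i)) refl refl refl
      in <-irrefl refl (∈⇒leftEnd< Z Z∈G)

-- The bijection

treeVector : (T : BinaryTree n) → ∃[ l ] Realises l 0 n (proj₁ T)
treeVector (T , #T≡1+n) with realisable 0 T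
... | l , e , p with trans (sym (realises-#leaves p)) #T≡1+n
...   | refl = l , p

torsionClass : BinaryTree (suc m) → TorsionClass (suc m)
torsionClass T = bracket⇒torsion (proj₁ (treeVector T)) (realises⇒bracket (proj₂ (treeVector T)))

-- Any realising vector is allowed: surjectivity compares the vector of `treeVector` with `leftEnd`
-- by passing through `𝒟`.
realises⇒≐𝒟 : (T : BinaryTree (suc m)) → Realises l 0 (suc m) (proj₁ T) →
              (λ X → l (hi X) < lo X) ≐ 𝒟 T
realises⇒≐𝒟 T p =
  (λ {X} l<i → covers⇒𝒟 T X (bounds⇒covers p z≤n (s≤s (j≤n-1 X)) l<i (i≤j X))) ,
  (λ {X} X∈𝒟 → proj₂ (proj₂ (proj₂ (covers⇒bounds p (𝒟⇒covers T X X∈𝒟)))) (s≤s (j≤n-1 X)))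

torsionClass-≐𝒟 : (T : BinaryTree (suc m)) → 𝒢 (torsionClass T) ≐ 𝒟 T
torsionClass-≐𝒟 T = realises⇒≐𝒟 T (proj₂ (treeVector T))

-- The test ball is [l′ j, j]: if `l j < l′ j`, it satisfies the condition for `l` but not the one
-- for `l′`.
bracket-≤ : Bracket l′ 0 (suc m) → (∀ (X : Ball (suc m)) → l (hi X) < lo X → l′ (hi X) < lo X) →
            j < suc m → l′ j ≤ l j
bracket-≤ bracket′ imp j≤m = ≮⇒≥ λ lj<l′j → <-irrefl refl
  (imp (ball _ _ (≤-trans z<s lj<l′j) (upper bracket′ z≤n j≤m) (s≤s⁻¹ j≤m)) lj<l′j)

binaryTree-≡ : {T T′ : BinaryTree n} → proj₁ T ≡ proj₁ T′ → T ≡ T′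
binaryTree-≡ {T = _ , eq} {_ , eq′} refl = cong (_ ,_) (≡-irrelevant eq eq′)

torsionClass-injective : (T T′ : BinaryTree (suc m)) →
                         𝒢 (torsionClass T) ≐ 𝒢 (torsionClass T′) → T ≡ T′
torsionClass-injective T T′ (sub , sup) with treeVector T | treeVector T′
... | l , p | l′ , p′ = binaryTree-≡ (realises-unique (realises-cong l≗l′ p) p′)
  where
  l≗l′ : ∀ {j} → 0 ≤ j → j < _ → l j ≡ l′ j
  l≗l′ _ j≤m = ≤-antisym
    (bracket-≤ (realises⇒bracket p) (λ X → sup {X}) j≤m)
    (bracket-≤ (realises⇒bracket p′) (λ X → sub {X}) j≤m)

torsionClass-surjective : (G : TorsionClass (suc m)) →
                          ∃[ T ] 𝒢 (torsionClass T) ≐ 𝒢 G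
torsionClass-surjective {m} G with bracket⇒realised (suc m) ≤-refl z≤n (torsion⇒bracket G)
... | S , p = tree ,
  (λ {X} → leftEnd<⇒∈ G X ∘ proj₂ (realises⇒≐𝒟 tree p) {X} ∘ proj₁ (torsionClass-≐𝒟 tree) {X}) ,
  (λ {X} → proj₂ (torsionClass-≐𝒟 tree) {X} ∘ proj₁ (realises⇒≐𝒟 tree p) {X} ∘ ∈⇒leftEnd< G X)
  where
  tree : BinaryTree (suc m)
  tree = S , realises-#leaves p

theorem4p6 : (n : ℕ) → 1 ≤ n →
    Σ[ f ∈ Bijection (binaryTrees n) (torsionClasses n) ]
    ((T : BinaryTree n) → 𝒢 (Bijection.to f T) ≐ 𝒟 T) ×
    ((T₁ T₂ : BinaryTree n) → T₁ ≤ᵀ T₂ → 𝒢 (Bijection.to f T₁) ⊇ 𝒢 (Bijection.to f T₂))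
theorem4p6 (suc m) _ = f , torsionClass-≐𝒟 , order-reversing
  where
  f : Bijection (binaryTrees (suc m)) (torsionClasses (suc m))
  f = record
    { to        = torsionClass
    ; cong      = λ { refl → (λ x → x) , (λ x → x) }
    ; bijective = (λ {T} {T′} → torsionClass-injective T T′) , λ G →
        let T , T≐G = torsionClass-surjective G in T , λ { refl → T≐G }
    }

  order-reversing : (T₁ T₂ : BinaryTree (suc m)) → T₁ ≤ᵀ T₂ →
                    𝒢 (torsionClass T₁) ⊇ 𝒢 (torsionClass T₂)
  order-reversing T₁ T₂ T₁≤T₂ {X} =
    proj₂ (torsionClass-≐𝒟 T₁) {X} ∘ ≤ᵀ⇒𝒟⊇ T₁ T₂ T₁≤T₂ {X} ∘ proj₁ (torsionClass-≐𝒟 T₂) {X}
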